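{- Given an essentially $4$-edge connected cubic simple graph $G=(V,E)$ with $|V|>6$ and edges $au, uv, vc, vd\in E$, no two subsets $S,S'\subset V$ different than $\{u,v\}$ exist such that $au,vd\in\delta(S)$, $au,vc\in\delta(S')$, and $|\delta(S)|=|\delta(S')|=4$.
   Context: $G=(V,E)$ is a simple undirected graph with vertex set $V$ and edge set $E$; it is cubic if every vertex has degree $3$. For $A\subset V$, the cut $\delta(A)$ is the set of edges of $G$ with one endpoint in $A$ and the other in $V\setminus A$. A component of a graph is a subgraph in which any two vertices are connected to each other by paths and which is not connected to any other vertex of the graph. An edge cut $F$ of $G$ (a set of the form $F=\delta(A)$) is essential if the graph $(V,E\setminus F)$ has at least two components each containing more than one vertex. For a natural number $k$, $G$ is essentially $k$-edge connected if and only if $G$ does not have an essential edge cut $F$ with $|F|<k$.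
   Formalization: S and S' are also required to differ from V∖{u,v}, since V∖{u,v} defines the same 4-edge cut as {u,v} and the claim as worded fails for it (even with S≠S', in the cube); the edges au, uv, vc, vd are taken to be pairwise distinct. -}

module Defs where

open import Level using (0ℓ)
open import Data.Nat using (ℕ; _<_)
open import Data.Fin using (Fin) renaming (_<_ to _<ᶠ_)
open import Data.Fin.Properties using (_<?_) renaming (_≟_ to _≟ᶠ_)
open import Data.Fin.Subset using (Subset; _∈_; _∉_; ∣_∣; Nonempty)
open import Data.Fin.Subset.Properties using (_∈?_)
open import Data.List using (List; length; filter; allFin; cartesianProduct)
open import Data.List.Relation.Unary.Any using (Any; any?)
import Data.List.Relation.Unary.Any as Any
open import Data.Product using (_×_; _,_; ∃-syntax; swap)
open import Data.Product.Properties using (≡-dec)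
open import Data.Sum using (_⊎_; inj₁; inj₂)
open import Function using (_∘_)
open import Relation.Nullary using (¬_)
open import Relation.Nullary.Decidable using (_×-dec_; _⊎-dec_; ¬?)
open import Relation.Unary using (Pred; Decidable)
open import Relation.Binary using (Rel; Symmetric; Irreflexive)
import Relation.Binary as B
open import Relation.Binary.PropositionalEquality
  using (_≡_; _≢_)
open import Relation.Binary.Construct.Closure.ReflexiveTransitive using (Star)

record SimpleGraph (n : ℕ) : Set₁ where
  infix 4 _∼_ _∼?_
  field
    _∼_      : Rel (Fin n) 0ℓ
    _∼?_     : B.Decidable _∼_
    ∼-sym    : Symmetric _∼_
    ∼-irrefl : Irreflexive _≡_ _∼_

open SimpleGraph using (∼-sym; ∼-irrefl)

private
  variable
    n : ℕ

degree : SimpleGraph n → Fin n → ℕ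
degree {n} G x = length (filter (x ∼?_) (allFin n))
  where open SimpleGraph G

Cubic : SimpleGraph n → Set
Cubic G = ∀ x → degree G x ≡ 3

-- A pair (x , y) stands for the undirected edge xy, so pairs are compared
-- up to swapping.  Edge sets are duplicate-free lists holding each edge once,
-- as the pair with increasing entries; their cardinality is the length.

Pair : ℕ → Set
Pair n = Fin n × Fin n

infix 4 _≈ᵉ_ _≈ᵉ?_ _≉ᵉ_ _∈ᵉ_ _∈ᵉ?_

_≈ᵉ_ : Rel (Pair n) 0ℓ
e ≈ᵉ f = e ≡ f ⊎ swap e ≡ f

_≉ᵉ_ : Rel (Pair n) 0ℓ
e ≉ᵉ f = ¬ (e ≈ᵉ f)

_≈ᵉ?_ : B.Decidable (_≈ᵉ_ {n})
e ≈ᵉ? f = ≡-dec _≟ᶠ_ _≟ᶠ_ e f ⊎-dec ≡-dec _≟ᶠ_ _≟ᶠ_ (swap e) f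

_∈ᵉ_ : Pair n → List (Pair n) → Set
e ∈ᵉ F = Any (e ≈ᵉ_) F

_∈ᵉ?_ : B.Decidable (_∈ᵉ_ {n})
e ∈ᵉ? F = any? (e ≈ᵉ?_) F

∈ᵉ-swap : ∀ {e : Pair n} {F} → e ∈ᵉ F → swap e ∈ᵉ F
∈ᵉ-swap = Any.map λ where
  (inj₁ p) → inj₂ p
  (inj₂ p) → inj₁ p

module _ (G : SimpleGraph n) where
  open SimpleGraph G

  IsEdge : Pred (Pair n) 0ℓ
  IsEdge (x , y) = x <ᶠ y × x ∼ y

  isEdge? : Decidable IsEdge
  isEdge? (x , y) = x <? y ×-dec x ∼? y

  E : List (Pair n)
  E = filter isEdge? (cartesianProduct (allFin n) (allFin n))

Crosses : Subset n → Pred (Pair n) 0ℓ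
Crosses A (x , y) = (x ∈ A × y ∉ A) ⊎ (y ∈ A × x ∉ A)

crosses? : (A : Subset n) → Decidable (Crosses A)
crosses? A (x , y) =
  (x ∈? A ×-dec ¬? (y ∈? A)) ⊎-dec (y ∈? A ×-dec ¬? (x ∈? A))

δ : SimpleGraph n → Subset n → List (Pair n)
δ G A = filter (crosses? A) (E G)

infixl 6 _∖ᵉ_

-- The graph (V , E ∖ F).
_∖ᵉ_ : SimpleGraph n → List (Pair n) → SimpleGraph n
G ∖ᵉ F = record
  { _∼_      = λ x y → x ∼ y × ¬ ((x , y) ∈ᵉ F)
  ; _∼?_     = λ x y → x ∼? y ×-dec ¬? ((x , y) ∈ᵉ? F)
  ; ∼-sym    = λ (p , q) → ∼-sym G p , q ∘ ∈ᵉ-swap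
  ; ∼-irrefl = λ eq (p , _) → ∼-irrefl G eq p
  }
  where open SimpleGraph G using (_∼_; _∼?_)

Connected : SimpleGraph n → Rel (Fin n) 0ℓ
Connected G = Star (SimpleGraph._∼_ G)

-- A component is given by its vertex set.
IsComponent : SimpleGraph n → Subset n → Set
IsComponent G C =
  Nonempty C ×
  (∀ {x y} → x ∈ C → y ∈ C → Connected G x y) ×
  (∀ {x y} → x ∈ C → y ∉ C → ¬ Connected G x y)

IsEdgeCut : SimpleGraph n → List (Pair n) → Set
IsEdgeCut G F = ∃[ A ] F ≡ δ G A

Essential : SimpleGraph n → List (Pair n) → Set
Essential G F = ∃[ C ] ∃[ D ]
  C ≢ D ×
  IsComponent (G ∖ᵉ F) C × 1 < ∣ C ∣ ×
  IsComponent (G ∖ᵉ F) D × 1 < ∣ D ∣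

EssentiallyEdgeConnected : ℕ → SimpleGraph n → Set
EssentiallyEdgeConnected k G =
  ¬ (∃[ F ] IsEdgeCut G F × Essential G F × length F < k)

{-# OPTIONS --safe #-}
module Submission where

-- Write ∂ A for the size of the cut of a vertex set A.  Three facts about a
-- cubic, essentially 4-edge connected graph on more than six vertices carry
-- the proof.
--
-- (1) Adding a vertex with k neighbours in A changes ∂ A by 3 - 2k (∂-add).
-- (2) If ∂ A is at most 3, then A or its complement has at most one vertex
--     (outside-unique, inside-unique).  Two vertices on a side of a cut of
--     size at most 5 force an edge inside that side (inner-edge), so otherwise
--     removing the cut would leave a nontrivial component on each side.
-- (3) There is no triangle and no K₂,₃ (no-triangle, no-K₂,₃): by (1), their
--     vertex sets have cuts of size at most 3, which (2) forbids.
--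
-- Suppose the theorem fails for the sets S and T, where au and vd cross the cut
-- of S, and au and vc that of T.  Replacing either set by its complement if
-- necessary, let u belong to both, so that a belongs to neither (normalise).  If v were outside S, adding it would give a cut of size at most
-- 3, so by (2) only a and v would lie outside S; since ∂ S is 4, a and v would
-- be adjacent, giving the triangle a u v.  So v is in S and d is not.  If c
-- were outside S too, removing v would give a cut of size at most 3, so S would
-- be the pair u, v.  Hence c is in S (cut-sides); likewise v and d are in T,
-- and c is not.
--
-- The edge au joins the intersection of S and T to the complement of their
-- union, so ∂ (S - T) + ∂ (T - S) is at most 4 + 4 - 2 = 6 (∂-posimodular).
-- Both summands are at least 3 by 3≤∂, hence equal to 3, and (2) shows that
-- S - T consists of c and T - S of d.  As ∂ T is 4 and the intersection has a
-- cut of size at least 4, (1) gives d two neighbours in the intersection.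
-- So adding d to S gives the union of S and T a cut of size at most 3, and by
-- (2) only a lies outside the union.  The complement of S is therefore the
-- pair a, d; as ∂ S is 4, a and d are adjacent (crossing-cuts-adjacent).
-- Likewise a and c are adjacent.  Now a and v are both adjacent to c, d
-- and u: a K₂,₃, contradicting (3).

open import Defs
open import Level using (0ℓ)
open import Data.Nat using (ℕ; suc; _+_; _*_; _≤_; _<_; z≤n; s≤s)
open import Data.Nat.Properties hiding (_≟_; <-cmp; <⇒≢)
open import Algebra.Properties.CommutativeSemigroup +-commutativeSemigroup using (interchange)
open import Data.Nat.ListAction using (sum)
open import Data.Nat.ListAction.Properties using (sum-++)
open import Data.Nat.Tactic.RingSolver using (solve-∀)
open import Data.Bool using (Bool; true; false; not; _∧_; _∨_; _xor_)
open import Data.Bool.Properties using (not-involutive; ¬-not; xor-comm; xor-same; xor-identityʳ; not-injective)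
open import Data.Empty using (⊥)
open import Data.Fin using (Fin)
open import Data.Fin.Properties using (_≟_; any?; <-cmp; <⇒≢; pigeonhole)
open import Data.Fin.Subset using (Subset; ⁅_⁆; _∪_; ∁; _⊃_) renaming (_∈_ to _∈ˢ_; _∉_ to _∉ˢ_; ∣_∣ to ∣_∣ˢ)
open import Data.Fin.Subset.Properties
  using (_∈?_; x∈⁅x⁆; x∈⁅y⁆⇒x≡y; x∈p∪q⁻; x∈p∪q⁺; p⊆p∪q; ∣⁅x⁆∣≡1; p⊂q⇒∣p∣<∣q∣)
open import Data.Fin.Subset.Induction using (⊃-wellFounded; Acc; acc)
open import Data.List using (List; length; []; _∷_; map; _++_; filter; allFin; cartesianProduct)
open import Data.List.Properties using (map-++; map-∘)
open import Data.List.Membership.Propositional using (_∈_; _∉_; lose; find)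
open import Data.List.Membership.Propositional.Properties
  using (∈-filter⁺; ∈-filter⁻; ∈-allFin; ∈-cartesianProduct⁺)
open import Data.List.Membership.DecPropositional using () renaming (_∈?_ to _∈ˡ?_)
import Data.Bool as Bool
import Data.List.Membership.Setoid.Properties as Membership
open import Data.List.Relation.Unary.All using ([]; _∷_)
open import Data.List.Relation.Unary.All.Properties using (All¬⇒¬Any)
open import Data.List.Relation.Unary.AllPairs using (AllPairs; []; _∷_)
open import Data.List.Relation.Unary.Any using (here; there; index)
open import Data.List.Relation.Unary.Unique.Propositional using (Unique)
open import Data.List.Relation.Unary.Unique.Propositional.Properties using (allFin⁺)
open import Data.Product using (_×_; _,_; ∃-syntax; proj₁; proj₂)
open import Data.Sum using (_⊎_; inj₁; inj₂; [_,_]′)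
open import Data.Unit using (tt)
open import Data.Vec using (lookup; tabulate)
open import Data.Vec.Properties using ([]=⇒lookup; lookup⇒[]=; lookup∘tabulate; lookup-map; tabulate∘lookup; tabulate-cong)
open import Function using (_∘_; case_of_)
open import Relation.Binary using (tri<; tri≈; tri>)
open import Relation.Binary.Construct.Closure.ReflexiveTransitive using (ε; _◅_; _◅◅_; reverse)
open import Relation.Binary.PropositionalEquality
open import Relation.Nullary using (¬_; Dec; yes; no; does; contradiction)
open import Relation.Nullary.Decidable using (dec-true; dec-false; decidable-stable; _×-dec_; ¬?)
open import Relation.Unary using (Pred; Decidable)

private variable
  X Y : Set
  n   : ℕ

-- Finite sums of natural numbers

-- The indicator of a Boolean.
𝟙 : Bool → ℕ
𝟙 true  = 1
𝟙 false = 0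

∑ : (X → ℕ) → List X → ℕ
∑ f xs = sum (map f xs)

∑-cong : ∀ {f g : X → ℕ} xs → (∀ {x} → x ∈ xs → f x ≡ g x) → ∑ f xs ≡ ∑ g xs
∑-cong []       _  = refl
∑-cong (x ∷ xs) eq = cong₂ _+_ (eq (here refl)) (∑-cong xs (eq ∘ there))

∑-mono : ∀ {f g : X → ℕ} xs → (∀ {x} → x ∈ xs → f x ≤ g x) → ∑ f xs ≤ ∑ g xs
∑-mono []       _  = z≤n
∑-mono (x ∷ xs) le = +-mono-≤ (le (here refl)) (∑-mono xs (le ∘ there))

-- A termwise bound with slack k at one term gives slack k for the sums.
∑-mono-slack : ∀ {f g : X → ℕ} {x xs} k → x ∈ xs →
  (∀ {y} → y ∈ xs → f y ≤ g y) → k + f x ≤ g x → k + ∑ f xs ≤ ∑ g xs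
∑-mono-slack {f = f} {xs = x ∷ xs} k (here refl) le slack = begin
  k + (f x + ∑ f xs)  ≡⟨ +-assoc k (f x) _ ⟨
  k + f x + ∑ f xs    ≤⟨ +-mono-≤ slack (∑-mono xs (le ∘ there)) ⟩
  _                   ∎
  where open ≤-Reasoning
∑-mono-slack {f = f} {xs = y ∷ xs} k (there x∈) le slack = begin
  k + (f y + ∑ f xs)  ≡⟨ +-comm k _ ⟩
  f y + ∑ f xs + k    ≡⟨ +-assoc (f y) _ k ⟩
  f y + (∑ f xs + k)  ≡⟨ cong (f y +_) (+-comm _ k) ⟩
  f y + (k + ∑ f xs)  ≤⟨ +-mono-≤ (le (here refl)) (∑-mono-slack k x∈ (le ∘ there) slack) ⟩
  _                   ∎
  where open ≤-Reasoning

∑-+ : ∀ (f g : X → ℕ) xs → ∑ (λ x → f x + g x) xs ≡ ∑ f xs + ∑ g xs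
∑-+ f g []       = refl
∑-+ f g (x ∷ xs) = trans (cong (f x + g x +_) (∑-+ f g xs)) (interchange (f x) (g x) _ _)

∑-*ˡ : ∀ k (f : X → ℕ) xs → ∑ (λ x → k * f x) xs ≡ k * ∑ f xs
∑-*ˡ k f []       = sym (*-zeroʳ k)
∑-*ˡ k f (x ∷ xs) = trans (cong (k * f x +_) (∑-*ˡ k f xs)) (sym (*-distribˡ-+ k (f x) _))

∑-0 : ∀ {f : X → ℕ} xs → (∀ {x} → x ∈ xs → f x ≡ 0) → ∑ f xs ≡ 0
∑-0 xs eq = trans (∑-cong xs eq) (∑-*ˡ 0 (λ _ → 0) xs)

∑-filter : ∀ {P : Pred X 0ℓ} (P? : Decidable P) (f : X → ℕ) xs →
  ∑ f (filter P? xs) ≡ ∑ (λ x → 𝟙 (does (P? x)) * f x) xs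
∑-filter P? f []       = refl
∑-filter P? f (x ∷ xs) with does (P? x)
... | true  = cong₂ _+_ (sym (*-identityˡ (f x))) (∑-filter P? f xs)
... | false = ∑-filter P? f xs

length-filter : ∀ {P : Pred X 0ℓ} (P? : Decidable P) xs →
  length (filter P? xs) ≡ ∑ (λ x → 𝟙 (does (P? x))) xs
length-filter P? []       = refl
length-filter P? (x ∷ xs) with does (P? x)
... | true  = cong suc (length-filter P? xs)
... | false = length-filter P? xs

∑-cartesianProduct : ∀ (f : X × Y → ℕ) xs ys →
  ∑ f (cartesianProduct xs ys) ≡ ∑ (λ x → ∑ (λ y → f (x , y)) ys) xs
∑-cartesianProduct f []       ys = refl
∑-cartesianProduct f (x ∷ xs) ys = begin
  sum (map f (map (x ,_) ys ++ cartesianProduct xs ys))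
    ≡⟨ cong sum (map-++ f (map (x ,_) ys) _) ⟩
  sum (map f (map (x ,_) ys) ++ map f (cartesianProduct xs ys))
    ≡⟨ sum-++ (map f (map (x ,_) ys)) _ ⟩
  sum (map f (map (x ,_) ys)) + ∑ f (cartesianProduct xs ys)
    ≡⟨ cong₂ _+_ (cong sum (sym (map-∘ ys))) (∑-cartesianProduct f xs ys) ⟩
  ∑ (λ y → f (x , y)) ys + ∑ (λ x → ∑ (λ y → f (x , y)) ys) xs ∎
  where open ≡-Reasoning

-- The Kronecker delta.
⟦_≡_⟧ : Fin n → Fin n → ℕ
⟦ x ≡ y ⟧ = 𝟙 (does (x ≟ y))

⟦≡⟧-refl : ∀ (x : Fin n) → ⟦ x ≡ x ⟧ ≡ 1
⟦≡⟧-refl x = cong 𝟙 (dec-true (x ≟ x) refl)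

⟦≡⟧-≢ : ∀ {x y : Fin n} → x ≢ y → ⟦ x ≡ y ⟧ ≡ 0
⟦≡⟧-≢ {x = x} {y} x≢y = cong 𝟙 (dec-false (x ≟ y) x≢y)

∑-sift : ∀ (f : Fin n → ℕ) v → ∑ (λ x → ⟦ x ≡ v ⟧ * f x) (allFin n) ≡ f v
∑-sift {n} f v = go (allFin⁺ n) (∈-allFin v)
  where
  open ≡-Reasoning
  go : ∀ {xs} → Unique xs → v ∈ xs → ∑ (λ x → ⟦ x ≡ v ⟧ * f x) xs ≡ f v
  go {_ ∷ xs} (v∉ ∷ _) (here refl) = begin
    ⟦ v ≡ v ⟧ * f v + ∑ (λ x → ⟦ x ≡ v ⟧ * f x) xs
      ≡⟨ cong₂ _+_ (cong (_* f v) (⟦≡⟧-refl v)) (∑-0 {f = λ x → ⟦ x ≡ v ⟧ * f x} xs zeros) ⟩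
    1 * f v + 0  ≡⟨ +-identityʳ _ ⟩
    1 * f v      ≡⟨ *-identityˡ _ ⟩
    f v          ∎
    where
    zeros : ∀ {x} → x ∈ xs → ⟦ x ≡ v ⟧ * f x ≡ 0
    zeros {x} x∈ = cong (_* f x) (⟦≡⟧-≢ λ x≡v → All¬⇒¬Any v∉ (subst (_∈ xs) x≡v x∈))
  go {x ∷ xs} (x∉ ∷ u) (there v∈) = cong₂ _+_
    (cong (_* f x) (⟦≡⟧-≢ {x = x} {v} λ x≡v → All¬⇒¬Any x∉ (subst (_∈ xs) (sym x≡v) v∈))) (go u v∈)

term≤∑ : ∀ (f : Fin n → ℕ) x → f x ≤ ∑ f (allFin n)
term≤∑ {n} f x = begin
  f x                                    ≡⟨ ∑-sift f x ⟨
  ∑ (λ z → ⟦ z ≡ x ⟧ * f z) (allFin n)   ≤⟨ ∑-mono (allFin n) (λ {z} _ → le z) ⟩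
  ∑ f (allFin n)                         ∎
  where
  open ≤-Reasoning
  le : ∀ z → ⟦ z ≡ x ⟧ * f z ≤ f z
  le z with does (z ≟ x)
  ... | true  = ≤-reflexive (*-identityˡ (f z))
  ... | false = z≤n

two-terms≤∑ : ∀ (f : Fin n → ℕ) {x y} → x ≢ y → f x + f y ≤ ∑ f (allFin n)
two-terms≤∑ {n} f {x} {y} x≢y = begin
  f x + f y                                                      ≡⟨ cong₂ _+_ (∑-sift f x) (∑-sift f y) ⟨
  ∑ (λ z → ⟦ z ≡ x ⟧ * f z) (allFin n) + ∑ (λ z → ⟦ z ≡ y ⟧ * f z) (allFin n)
                                                                 ≡⟨ ∑-+ _ _ (allFin n) ⟨
  ∑ (λ z → ⟦ z ≡ x ⟧ * f z + ⟦ z ≡ y ⟧ * f z) (allFin n)         ≤⟨ ∑-mono (allFin n) (λ {z} _ → le z) ⟩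
  ∑ f (allFin n)                                                 ∎
  where
  open ≤-Reasoning
  le : ∀ z → ⟦ z ≡ x ⟧ * f z + ⟦ z ≡ y ⟧ * f z ≤ f z
  le z with z ≟ x | z ≟ y
  ... | yes refl | yes refl = contradiction refl x≢y
  ... | yes _    | no _     = ≤-reflexive (trans (+-identityʳ _) (*-identityˡ (f z)))
  ... | no _     | yes _    = ≤-reflexive (*-identityˡ (f z))
  ... | no _     | no _     = z≤n

fresh : ∀ (xs : List (Fin n)) → length xs < n → ∃[ z ] z ∉ xs
fresh {n} xs short with any? (λ z → ¬? (_∈ˡ?_ _≟_ z xs))
... | yes found = found
... | no none   =
  let i , j , i<j , eq = pigeonhole short (index ∘ all∈)
  in contradiction (Membership.index-injective (setoid (Fin n)) (all∈ i) (all∈ j) eq) (<⇒≢ i<j)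
  where
  all∈ : ∀ z → z ∈ xs
  all∈ z = decidable-stable (_∈ˡ?_ _≟_ z xs) λ z∉ → none (z , z∉)

not-xor-not : ∀ p q → not p xor not q ≡ p xor q
not-xor-not true  q = refl
not-xor-not false q = not-involutive q

-- Vertex sets

-- Vertex sets as characteristic functions, so that set operations compute
-- pointwise; a Subset S corresponds to lookup S.
VSet : ℕ → Set
VSet n = Fin n → Bool

-- Insertion of a vertex.
infixl 6 _⊕_
_⊕_ : VSet n → Fin n → VSet n
(A ⊕ v) x = does (x ≟ v) ∨ A x

-- Deletion of a vertex.
infixl 6 _⊖_
_⊖_ : VSet n → Fin n → VSet n
(A ⊖ v) x = not (does (x ≟ v)) ∧ A x

infixl 6 _∩ᵛ_ _∪ᵛ_ _∖ᵛ_

_∩ᵛ_ _∪ᵛ_ _∖ᵛ_ : VSet n → VSet n → VSet n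
(A ∩ᵛ B) x = A x ∧ B x
(A ∪ᵛ B) x = A x ∨ B x
(A ∖ᵛ B) x = A x ∧ not (B x)

-- A is the set with elements u and v, which are allowed to coincide.
IsPair : Fin n → Fin n → VSet n → Set
IsPair u v A = A u ≡ true × A v ≡ true × (∀ x → A x ≡ true → x ≡ u ⊎ x ≡ v)

pair-lookup : ∀ {u v} {A : VSet n} → IsPair u v A → ∀ x → lookup (⁅ u ⁆ ∪ ⁅ v ⁆) x ≡ A x
pair-lookup {u = u} {v} {A} (Au , Av , only) x with A x in Ax
... | true  = []=⇒lookup (x∈p∪q⁺ {p = ⁅ u ⁆} {⁅ v ⁆}
  ([ (λ { refl → inj₁ (x∈⁅x⁆ u) }) , (λ { refl → inj₂ (x∈⁅x⁆ v) }) ]′ (only x Ax)))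
... | false = ¬-not λ x∈ → case trans (sym Ax) ([ (λ x∈u → trans (cong A (x∈⁅y⁆⇒x≡y u x∈u)) Au)
                                                , (λ x∈v → trans (cong A (x∈⁅y⁆⇒x≡y v x∈v)) Av)
                                                ]′ (x∈p∪q⁻ ⁅ u ⁆ ⁅ v ⁆ (lookup⇒[]= x _ x∈))) of λ ()

lookup-ext : ∀ {S T : Subset n} → (∀ x → lookup S x ≡ lookup T x) → S ≡ T
lookup-ext {S = S} {T} eq = trans (sym (tabulate∘lookup S)) (trans (tabulate-cong eq) (tabulate∘lookup T))

-- Components

-- The vertex set of the component of p, found by growing the singleton of p
-- until no edge leaves the set.
componentOf : ∀ (H : SimpleGraph n) p → ∃[ C ] IsComponent H C × p ∈ˢ C
componentOf {n} H p =
  grow ⁅ p ⁆ (⊃-wellFounded ⁅ p ⁆) (x∈⁅x⁆ p) λ x∈ → subst (Connected H p) (sym (x∈⁅y⁆⇒x≡y p x∈)) ε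
  where
  open SimpleGraph H
  grow : ∀ C → Acc _⊃_ C → p ∈ˢ C → (∀ {x} → x ∈ˢ C → Connected H p x) →
         ∃[ D ] IsComponent H D × p ∈ˢ D
  grow C (acc rec) p∈C conn
    with any? (λ x → any? (λ y → (x ∈? C) ×-dec (x ∼? y) ×-dec ¬? (y ∈? C)))
  ... | yes (x , y , x∈C , x∼y , y∉C) =
    grow (C ∪ ⁅ y ⁆) (rec C⊂C∪y) (proj₁ C⊂C∪y p∈C) λ z∈ →
      [ conn , (λ z∈y → subst (Connected H p) (sym (x∈⁅y⁆⇒x≡y y z∈y)) (conn x∈C ◅◅ x∼y ◅ ε)) ]′
        (x∈p∪q⁻ C ⁅ y ⁆ z∈)
    where
    C⊂C∪y : (C ∪ ⁅ y ⁆) ⊃ C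
    C⊂C∪y = p⊆p∪q ⁅ y ⁆ , y , x∈p∪q⁺ (inj₂ (x∈⁅x⁆ y)) , y∉C
  ... | no closed =
    C , ((p , p∈C) , (λ x∈ y∈ → reverse ∼-sym (conn x∈) ◅◅ conn y∈) ,
         λ x∈ y∉ x⋯y → y∉ (stays x∈ x⋯y)) , p∈C
    where
    stays : ∀ {x y} → x ∈ˢ C → Connected H x y → y ∈ˢ C
    stays x∈ ε = x∈
    stays {x} x∈ (_◅_ {j = z} x∼z path) =
      stays (decidable-stable (z ∈? C) λ z∉ → closed (x , z , x∈ , x∼z , z∉)) path

two≤∣∣ : ∀ {C : Subset n} {x y} → x ≢ y → x ∈ˢ C → y ∈ˢ C → 1 < ∣ C ∣ˢ
two≤∣∣ {C = C} {x} {y} x≢y x∈ y∈ = subst (_< ∣ C ∣ˢ) (∣⁅x⁆∣≡1 x)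
  (p⊂q⇒∣p∣<∣q∣ ((λ z∈ → subst (_∈ˢ C) (sym (x∈⁅y⁆⇒x≡y x z∈)) x∈) , y , y∈ , λ y∈x → x≢y (sym (x∈⁅y⁆⇒x≡y x y∈x))))

module _ (G : SimpleGraph n) where
  open SimpleGraph G

  -- Edges and incidence

  -- The adjacency matrix.
  adj : Fin n → Fin n → ℕ
  adj x y = 𝟙 (does (x ∼? y))

  adj-∼ : ∀ {x y} → x ∼ y → adj x y ≡ 1
  adj-∼ {x} {y} x∼y = cong 𝟙 (dec-true (x ∼? y) x∼y)

  adj-≁ : ∀ {x y} → ¬ x ∼ y → adj x y ≡ 0
  adj-≁ {x} {y} x≁y = cong 𝟙 (dec-false (x ∼? y) x≁y)

  ∈E⇒∼ : ∀ {x y} → (x , y) ∈ E G → x ∼ y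
  ∈E⇒∼ xy∈ = proj₂ (proj₂ (∈-filter⁻ (isEdge? G) {xs = cartesianProduct (allFin n) (allFin n)} xy∈))

  ∈ᵉE⇒∼ : ∀ {x y} → (x , y) ∈ᵉ E G → x ∼ y
  ∈ᵉE⇒∼ xy∈ with find xy∈
  ... | _ , e∈ , inj₁ refl = ∈E⇒∼ e∈
  ... | _ , e∈ , inj₂ refl = ∼-sym (∈E⇒∼ e∈)

  ∼⇒≢ : ∀ {x y} → x ∼ y → x ≢ y
  ∼⇒≢ x∼y refl = ∼-irrefl refl x∼y

  ∼⇒∈E : ∀ {x y} → x ∼ y → (x , y) ∈ E G ⊎ (y , x) ∈ E G
  ∼⇒∈E {x} {y} x∼y with <-cmp x y
  ... | tri< x<y _ _ = inj₁ (∈-filter⁺ (isEdge? G) (∈-cartesianProduct⁺ (∈-allFin x) (∈-allFin y)) (x<y , x∼y))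
  ... | tri≈ _ x≡y _ = contradiction x≡y (∼⇒≢ x∼y)
  ... | tri> _ _ y<x = inj₂ (∈-filter⁺ (isEdge? G) (∈-cartesianProduct⁺ (∈-allFin y) (∈-allFin x)) (y<x , ∼-sym x∼y))

  private
    -- The indicator of an edge listed with increasing entries.
    w : Fin n → Fin n → ℕ
    w x y = 𝟙 (does (isEdge? G (x , y)))

    w-edge : ∀ {x y} → IsEdge G (x , y) → w x y ≡ 1
    w-edge p = cong 𝟙 (dec-true (isEdge? G _) p)

    w-no : ∀ {x y} → ¬ IsEdge G (x , y) → w x y ≡ 0
    w-no p = cong 𝟙 (dec-false (isEdge? G _) p)

    w+w : ∀ x y → w x y + w y x ≡ adj x y
    w+w x y = go (x ∼? y)
      where
      go : Dec (x ∼ y) → w x y + w y x ≡ adj x y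
      go (no x≁y) = trans (cong₂ _+_ (w-no (x≁y ∘ proj₂)) (w-no (x≁y ∘ ∼-sym ∘ proj₂))) (sym (adj-≁ x≁y))
      go (yes x∼y) with <-cmp x y
      ... | tri< x<y _ y≮x = trans (cong₂ _+_ (w-edge (x<y , x∼y)) (w-no (y≮x ∘ proj₁))) (sym (adj-∼ x∼y))
      ... | tri≈ _ x≡y _   = contradiction x≡y (∼⇒≢ x∼y)
      ... | tri> x≮y _ y<x = trans (cong₂ _+_ (w-no (x≮y ∘ proj₁)) (w-edge (y<x , ∼-sym x∼y))) (sym (adj-∼ x∼y))

  -- Summing, over the edges at v, the value of g at the other endpoint amounts to
  -- summing g over the neighbours of v.  The edge list holds each edge in one
  -- orientation, so v may be either entry.
  ∑-incident : ∀ (g : Fin n → ℕ) v →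
    ∑ (λ (x , y) → ⟦ x ≡ v ⟧ * g y + ⟦ y ≡ v ⟧ * g x) (E G) ≡ ∑ (λ y → adj v y * g y) (allFin n)
  ∑-incident g v = begin
    ∑ inc (E G)
      ≡⟨ ∑-filter (isEdge? G) inc (cartesianProduct V V) ⟩
    ∑ (λ (x , y) → w x y * inc (x , y)) (cartesianProduct V V)
      ≡⟨ ∑-cartesianProduct _ V V ⟩
    ∑ (λ x → ∑ (λ y → w x y * inc (x , y)) V) V
      ≡⟨ ∑-cong V (λ {x} _ → row x) ⟩
    ∑ (λ x → ⟦ x ≡ v ⟧ * ∑ (λ y → w x y * g y) V + w x v * g x) V
      ≡⟨ ∑-+ _ _ V ⟩
    ∑ (λ x → ⟦ x ≡ v ⟧ * ∑ (λ y → w x y * g y) V) V + ∑ (λ x → w x v * g x) V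
      ≡⟨ cong (_+ ∑ (λ x → w x v * g x) V) (∑-sift _ v) ⟩
    ∑ (λ y → w v y * g y) V + ∑ (λ y → w y v * g y) V
      ≡⟨ ∑-+ _ _ V ⟨
    ∑ (λ y → w v y * g y + w y v * g y) V
      ≡⟨ ∑-cong V (λ {y} _ → trans (sym (*-distribʳ-+ (g y) (w v y) _)) (cong (_* g y) (w+w v y))) ⟩
    ∑ (λ y → adj v y * g y) V ∎
    where
    open ≡-Reasoning
    V = allFin n
    inc : Pair n → ℕ
    inc (x , y) = ⟦ x ≡ v ⟧ * g y + ⟦ y ≡ v ⟧ * g x
    swap-mid : ∀ p q r s t → p * (q * r + s * t) ≡ q * (p * r) + s * (p * t)
    swap-mid = solve-∀
    row : ∀ x → ∑ (λ y → w x y * inc (x , y)) V ≡ ⟦ x ≡ v ⟧ * ∑ (λ y → w x y * g y) V + w x v * g x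
    row x = begin
      ∑ (λ y → w x y * inc (x , y)) V
        ≡⟨ ∑-cong V (λ {y} _ → swap-mid (w x y) ⟦ x ≡ v ⟧ (g y) ⟦ y ≡ v ⟧ (g x)) ⟩
      ∑ (λ y → ⟦ x ≡ v ⟧ * (w x y * g y) + ⟦ y ≡ v ⟧ * (w x y * g x)) V
        ≡⟨ ∑-+ _ _ V ⟩
      ∑ (λ y → ⟦ x ≡ v ⟧ * (w x y * g y)) V + ∑ (λ y → ⟦ y ≡ v ⟧ * (w x y * g x)) V
        ≡⟨ cong₂ _+_ (∑-*ˡ ⟦ x ≡ v ⟧ _ V) (∑-sift _ v) ⟩
      ⟦ x ≡ v ⟧ * ∑ (λ y → w x y * g y) V + w x v * g x ∎

  -- Cut sizes

  -- The number of edges with exactly one endpoint in A.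
  ∂ : VSet n → ℕ
  ∂ A = ∑ (λ (x , y) → 𝟙 (A x xor A y)) (E G)

  -- The number of neighbours of v in A.
  nbrs : Fin n → VSet n → ℕ
  nbrs v A = ∑ (λ y → adj v y * 𝟙 (A y)) (allFin n)

  ∂-cong : ∀ {A B} → (∀ x → A x ≡ B x) → ∂ A ≡ ∂ B
  ∂-cong eq = ∑-cong (E G) λ { {x , y} _ → cong₂ (λ p q → 𝟙 (p xor q)) (eq x) (eq y) }

  ∂-∁ : ∀ A → ∂ (not ∘ A) ≡ ∂ A
  ∂-∁ A = ∑-cong (E G) λ { {x , y} _ → cong 𝟙 (not-xor-not (A x) (A y)) }

  crosses : ∀ (S : Subset n) {x y} → lookup S x xor lookup S y ≡ true → Crosses S (x , y)
  crosses S {x} {y} eq with lookup S x in ex | lookup S y in ey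
  ... | true  | false = inj₁ (lookup⇒[]= x S ex , λ y∈ → case trans (sym ey) ([]=⇒lookup y∈) of λ ())
  ... | false | true  = inj₂ (lookup⇒[]= y S ey , λ x∈ → case trans (sym ex) ([]=⇒lookup x∈) of λ ())

  ∉⇒false : ∀ (S : Subset n) {x} → x ∉ˢ S → lookup S x ≡ false
  ∉⇒false S {x} x∉ = ¬-not (x∉ ∘ lookup⇒[]= x S)

  crosses⁻ : ∀ (S : Subset n) {x y} → Crosses S (x , y) → lookup S x xor lookup S y ≡ true
  crosses⁻ S (inj₁ (x∈ , y∉)) = cong₂ _xor_ ([]=⇒lookup x∈) (∉⇒false S y∉)
  crosses⁻ S (inj₂ (y∈ , x∉)) = cong₂ _xor_ (∉⇒false S x∉) ([]=⇒lookup y∈)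

  length-δ : ∀ S → length (δ G S) ≡ ∂ (lookup S)
  length-δ S = trans (length-filter (crosses? S) (E G)) (∑-cong (E G) λ { {e} _ → cong 𝟙 (agree e) })
    where
    agree : ∀ ((x , y) : Pair n) → does (crosses? S (x , y)) ≡ lookup S x xor lookup S y
    agree (x , y) with lookup S x xor lookup S y in eq
    ... | true  = dec-true (crosses? S (x , y)) (crosses S eq)
    ... | false = dec-false (crosses? S (x , y)) λ c → case trans (sym eq) (crosses⁻ S c) of λ ()

  ∈ᵉδ⇒xor : ∀ (S : Subset n) {x y} → (x , y) ∈ᵉ δ G S → lookup S x xor lookup S y ≡ true
  ∈ᵉδ⇒xor S xy∈ with find xy∈
  ... | _ , e∈ , inj₁ refl = crosses⁻ S (proj₂ (∈-filter⁻ (crosses? S) {xs = E G} e∈))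
  ... | _ , e∈ , inj₂ refl =
    trans (xor-comm (lookup S _) (lookup S _)) (crosses⁻ S (proj₂ (∈-filter⁻ (crosses? S) {xs = E G} e∈)))

  ∼-xor⇒∈ᵉδ : ∀ (S : Subset n) {x y} → x ∼ y → lookup S x xor lookup S y ≡ true → (x , y) ∈ᵉ δ G S
  ∼-xor⇒∈ᵉδ S x∼y eq with ∼⇒∈E x∼y
  ... | inj₁ e∈ = lose (∈-filter⁺ (crosses? S) e∈ (crosses S eq)) (inj₁ refl)
  ... | inj₂ e∈ = lose (∈-filter⁺ (crosses? S) e∈ (crosses S (trans (xor-comm (lookup S _) (lookup S _)) eq))) (inj₂ refl)

  nbrs-mono : ∀ v (A B : VSet n) → (∀ {x} → A x ≡ true → B x ≡ true) → nbrs v A ≤ nbrs v B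
  nbrs-mono v A B A⊆B = ∑-mono (allFin n) λ {y} _ → *-monoʳ-≤ (adj v y) (le y)
    where
    le : ∀ y → 𝟙 (A y) ≤ 𝟙 (B y)
    le y with A y in eq
    ... | false = z≤n
    ... | true  = ≤-reflexive (cong 𝟙 (sym (A⊆B eq)))

  nbrs≡0 : ∀ {v} (A : VSet n) → (∀ {x} → A x ≡ true → ¬ v ∼ x) → nbrs v A ≡ 0
  nbrs≡0 {v} A none = ∑-0 (allFin n) λ {y} _ → zer y
    where
    zer : ∀ y → adj v y * 𝟙 (A y) ≡ 0
    zer y with A y in eq
    ... | false = *-zeroʳ (adj v y)
    ... | true  = cong (_* 1) (adj-≁ (none eq))

  private
    nbr-term : ∀ {v x} (A : VSet n) → v ∼ x → A x ≡ true → 1 ≤ adj v x * 𝟙 (A x)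
    nbr-term A v∼x Ax = ≤-reflexive (sym (cong₂ (λ k b → k * 𝟙 b) (adj-∼ v∼x) Ax))

  1≤nbrs : ∀ {v x} (A : VSet n) → v ∼ x → A x ≡ true → 1 ≤ nbrs v A
  1≤nbrs {v} {x} A v∼x Ax = ≤-trans (nbr-term A v∼x Ax) (term≤∑ (λ y → adj v y * 𝟙 (A y)) x)

  2≤nbrs : ∀ {v x y} (A : VSet n) → x ≢ y → v ∼ x → A x ≡ true → v ∼ y → A y ≡ true → 2 ≤ nbrs v A
  2≤nbrs {v} A x≢y v∼x Ax v∼y Ay =
    ≤-trans (+-mono-≤ (nbr-term A v∼x Ax) (nbr-term A v∼y Ay)) (two-terms≤∑ (λ y → adj v y * 𝟙 (A y)) x≢y)

  -- B arises from A by adding the vertex v.  Being a relation, it applies to sets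
  -- that are only pointwise equal to A ⊕ v.
  record Adds (v : Fin n) (A B : VSet n) : Set where
    field
      before : A v ≡ false
      after  : B v ≡ true
      same   : ∀ {x} → x ≢ v → A x ≡ B x
  open Adds

  -- Components after removing a cut

  -- If an edge pq does not cross the cut of S, then the component of p in the graph
  -- without that cut is nontrivial and stays on the side of p.
  sideComponent : ∀ S {p q} → p ∼ q → lookup S p ≡ lookup S q →
    ∃[ C ] IsComponent (G ∖ᵉ δ G S) C × 1 < ∣ C ∣ˢ × p ∈ˢ C × (∀ {x} → x ∈ˢ C → lookup S x ≡ lookup S p)
  sideComponent S {p} {q} p∼q same with componentOf (G ∖ᵉ δ G S) p
  ... | C , comp@(_ , conn , sep) , p∈C = C , comp , two≤∣∣ (∼⇒≢ p∼q) p∈C q∈C , p∈C , λ x∈ → sym (constant (conn p∈C x∈))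
    where
    uncut : ∀ {x y} → lookup S x ≡ lookup S y → ¬ ((x , y) ∈ᵉ δ G S)
    uncut {x} {y} eq xy∈ = case trans (sym (xor-same (lookup S y))) (trans (cong (_xor lookup S y) (sym eq)) (∈ᵉδ⇒xor S xy∈)) of λ ()

    q∈C : q ∈ˢ C
    q∈C = decidable-stable (q ∈? C) λ q∉ → sep p∈C q∉ ((p∼q , uncut same) ◅ ε)

    xor≢true : ∀ a b → ¬ (a xor b ≡ true) → a ≡ b
    xor≢true true  true  _ = refl
    xor≢true true  false h = contradiction refl h
    xor≢true false true  h = contradiction refl h
    xor≢true false false _ = refl

    constant : ∀ {x y} → Connected (G ∖ᵉ δ G S) x y → lookup S x ≡ lookup S y
    constant ε = refl
    constant (_◅_ {i = x} {j = z} (x∼z , kept) path) =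
      trans (xor≢true (lookup S x) (lookup S z) (kept ∘ ∼-xor⇒∈ᵉδ S x∼z)) (constant path)

  -- There is an edge with both endpoints in A.
  InnerEdge : VSet n → Set
  InnerEdge A = ∃[ p ] ∃[ q ] p ∼ q × A p ≡ true × A q ≡ true

  essential-cut : ∀ {A} → InnerEdge A → InnerEdge (not ∘ A) → Essential G (δ G (tabulate A))
  essential-cut {A} (p , q , p∼q , Ap , Aq) (r , s , r∼s , Ar , As)
    with sideComponent (tabulate A) p∼q (trans (at p) (trans (trans Ap (sym Aq)) (sym (at q))))
       | sideComponent (tabulate A) r∼s (trans (at r) (trans (not-injective (trans Ar (sym As))) (sym (at s))))
    where
    at : ∀ x → lookup (tabulate A) x ≡ A x
    at = lookup∘tabulate A
  ... | C , compC , bigC , p∈C , _ | D , compD , bigD , _ , inD =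
    C , D , C≢D , compC , bigC , compD , bigD
    where
    C≢D : C ≢ D
    C≢D refl with trans (sym Ap) (trans (sym (lookup∘tabulate A p)) (trans (inD p∈C) (lookup∘tabulate A r)))
    ... | Ar′ = case trans (sym Ar) (cong not (sym Ar′)) of λ ()

  adds-⊕ : ∀ {v A} → A v ≡ false → Adds v A (A ⊕ v)
  adds-⊕ {v} {A} Av = record
    { before = Av
    ; after  = cong (_∨ A v) (dec-true (v ≟ v) refl)
    ; same   = λ {x} x≢v → cong (_∨ A x) (sym (dec-false (x ≟ v) x≢v))
    }

  adds-⊖ : ∀ {v A} → A v ≡ true → Adds v (A ⊖ v) A
  adds-⊖ {v} {A} Av = record
    { before = cong (λ b → not b ∧ A v) (dec-true (v ≟ v) refl)
    ; after  = Av
    ; same   = λ {x} x≢v → cong (λ b → not b ∧ A x) (dec-false (x ≟ v) x≢v)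
    }

  ⊖⊆ : ∀ v (A : VSet n) {x} → (A ⊖ v) x ≡ true → A x ≡ true
  ⊖⊆ v A {x} eq with does (x ≟ v)
  ... | false = eq

  -- Comparing cuts

  -- Posimodularity: an edge crosses S ∖ᵛ T and T ∖ᵛ S at most as often in total as
  -- it crosses S and T.  An edge from the intersection to the complement of the
  -- union crosses both S and T but neither difference, hence the slack 2.
  ∂-posimodular : ∀ {S T a u} → a ∼ u → S a ≡ false → T a ≡ false → S u ≡ true → T u ≡ true →
    2 + (∂ (S ∖ᵛ T) + ∂ (T ∖ᵛ S)) ≤ ∂ S + ∂ T
  ∂-posimodular {S} {T} {a} {u} a∼u Sa Ta Su Tu = begin
    2 + (∂ (S ∖ᵛ T) + ∂ (T ∖ᵛ S))    ≡⟨ cong (2 +_) (∑-+ _ _ (E G)) ⟨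
    2 + ∑ diffs (E G)                ≤⟨ bound ⟩
    ∑ both (E G)                     ≡⟨ ∑-+ _ _ (E G) ⟩
    ∂ S + ∂ T                        ∎
    where
    open ≤-Reasoning
    diffs both : Pair n → ℕ
    diffs (x , y) = 𝟙 ((S ∖ᵛ T) x xor (S ∖ᵛ T) y) + 𝟙 ((T ∖ᵛ S) x xor (T ∖ᵛ S) y)
    both  (x , y) = 𝟙 (S x xor S y) + 𝟙 (T x xor T y)

    edgewise : ∀ p q r s →
      𝟙 ((p ∧ not q) xor (r ∧ not s)) + 𝟙 ((q ∧ not p) xor (s ∧ not r)) ≤ 𝟙 (p xor r) + 𝟙 (q xor s)
    edgewise true  true  true  true  = ≤ᵇ⇒≤ _ _ tt
    edgewise true  true  true  false = ≤ᵇ⇒≤ _ _ tt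
    edgewise true  true  false true  = ≤ᵇ⇒≤ _ _ tt
    edgewise true  true  false false = ≤ᵇ⇒≤ _ _ tt
    edgewise true  false true  true  = ≤ᵇ⇒≤ _ _ tt
    edgewise true  false true  false = ≤ᵇ⇒≤ _ _ tt
    edgewise true  false false true  = ≤ᵇ⇒≤ _ _ tt
    edgewise true  false false false = ≤ᵇ⇒≤ _ _ tt
    edgewise false true  true  true  = ≤ᵇ⇒≤ _ _ tt
    edgewise false true  true  false = ≤ᵇ⇒≤ _ _ tt
    edgewise false true  false true  = ≤ᵇ⇒≤ _ _ tt
    edgewise false true  false false = ≤ᵇ⇒≤ _ _ tt
    edgewise false false true  true  = ≤ᵇ⇒≤ _ _ tt
    edgewise false false true  false = ≤ᵇ⇒≤ _ _ tt
    edgewise false false false true  = ≤ᵇ⇒≤ _ _ tt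
    edgewise false false false false = ≤ᵇ⇒≤ _ _ tt

    bound : 2 + ∑ diffs (E G) ≤ ∑ both (E G)
    bound with ∼⇒∈E a∼u
    ... | inj₁ au∈ = ∑-mono-slack 2 au∈ (λ { {x , y} _ → edgewise (S x) (T x) (S y) (T y) }) slack
      where
      slack : 2 + diffs (a , u) ≤ both (a , u)
      slack rewrite Sa | Ta | Su | Tu = ≤-refl
    ... | inj₂ ua∈ = ∑-mono-slack 2 ua∈ (λ { {x , y} _ → edgewise (S x) (T x) (S y) (T y) }) slack
      where
      slack : 2 + diffs (u , a) ≤ both (u , a)
      slack rewrite Sa | Ta | Su | Tu = ≤-refl

  module _ (cubic : Cubic G) where

    -- Cuts in cubic graphs

    -- Edges from v into A cease to be cut and the other edges at v become cut:
    -- with k edges into A, the cut changes by (3 - k) - k.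
    ∂-add : ∀ {v A B} → Adds v A B → ∂ B + 2 * nbrs v A ≡ ∂ A + 3
    ∂-add {v} {A} {B} add = begin
      ∂ B + 2 * nbrs v A
        ≡⟨ cong (λ k → ∂ B + 2 * k) (∑-incident (𝟙 ∘ A) v) ⟨
      ∂ B + 2 * ∑ (inc (𝟙 ∘ A)) (E G)
        ≡⟨ cong (∂ B +_) (∑-*ˡ 2 _ (E G)) ⟨
      ∂ B + ∑ (λ e → 2 * inc (𝟙 ∘ A) e) (E G)
        ≡⟨ ∑-+ _ _ (E G) ⟨
      ∑ (λ (x , y) → 𝟙 (B x xor B y) + 2 * inc (𝟙 ∘ A) (x , y)) (E G)
        ≡⟨ ∑-cong (E G) (λ { {x , y} xy∈ → edge x y (∼⇒≢ (∈E⇒∼ xy∈)) }) ⟩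
      ∑ (λ (x , y) → 𝟙 (A x xor A y) + inc (λ _ → 1) (x , y)) (E G)
        ≡⟨ ∑-+ _ _ (E G) ⟩
      ∂ A + ∑ (inc (λ _ → 1)) (E G)
        ≡⟨ cong (∂ A +_) (∑-incident (λ _ → 1) v) ⟩
      ∂ A + ∑ (λ y → adj v y * 1) (allFin n)
        ≡⟨ cong (∂ A +_) (∑-cong (allFin n) (λ _ → *-identityʳ _)) ⟩
      ∂ A + ∑ (adj v) (allFin n)
        ≡⟨ cong (∂ A +_) (trans (sym (length-filter (v ∼?_) (allFin n))) (cubic v)) ⟩
      ∂ A + 3 ∎
      where
      open ≡-Reasoning
      inc : (Fin n → ℕ) → Pair n → ℕ
      inc g (x , y) = ⟦ x ≡ v ⟧ * g y + ⟦ y ≡ v ⟧ * g x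
      edge : ∀ x y → x ≢ y →
        𝟙 (B x xor B y) + 2 * inc (𝟙 ∘ A) (x , y) ≡ 𝟙 (A x xor A y) + inc (λ _ → 1) (x , y)
      edge x y x≢y with x ≟ v | y ≟ v
      ... | yes refl | yes refl = contradiction refl x≢y
      ... | yes refl | no y≢v rewrite before add | after add | sym (same add y≢v) with A y
      ...   | true  = refl
      ...   | false = refl
      edge x y x≢y | no x≢v | yes refl rewrite before add | after add | sym (same add x≢v) with A x
      ...   | true  = refl
      ...   | false = refl
      edge x y x≢y | no x≢v | no y≢v rewrite same add x≢v | same add y≢v = refl

    -- If v has no neighbour in A, then all three edges at v are cut.
    ∂-isolated : ∀ {v A} → A v ≡ true → (∀ {x} → A x ≡ true → ¬ v ∼ x) → ∂ A ≡ ∂ (A ⊖ v) + 3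
    ∂-isolated {v} {A} Av none = begin
      ∂ A                            ≡⟨ +-identityʳ _ ⟨
      ∂ A + 2 * 0                    ≡⟨ cong (λ k → ∂ A + 2 * k) (nbrs≡0 (A ⊖ v) (none ∘ ⊖⊆ v A)) ⟨
      ∂ A + 2 * nbrs v (A ⊖ v)     ≡⟨ ∂-add (adds-⊖ Av) ⟩
      ∂ (A ⊖ v) + 3                  ∎
      where open ≡-Reasoning

    -- An independent set with at least two vertices would have a cut of size at least 6.
    inner-edge : ∀ {A x y} → x ≢ y → A x ≡ true → A y ≡ true → ∂ A ≤ 5 → InnerEdge A
    inner-edge {A} {x} {y} x≢y Ax Ay ∂≤5
      with any? (λ p → any? (λ q → (p ∼? q) ×-dec (A p Bool.≟ true) ×-dec (A q Bool.≟ true)))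
    ... | yes found = found
    ... | no none   = contradiction ∂≤5 (<⇒≱ (begin
      6                              ≤⟨ m≤n+m 6 _ ⟩
      ∂ (A ⊖ y ⊖ x) + 6            ≡⟨ +-assoc (∂ (A ⊖ y ⊖ x)) 3 3 ⟨
      ∂ (A ⊖ y ⊖ x) + 3 + 3        ≡⟨ cong (_+ 3) (∂-isolated A⊖yx (λ Az x∼z → none (_ , _ , x∼z , Ax , ⊖⊆ y A Az))) ⟨
      ∂ (A ⊖ y) + 3                ≡⟨ ∂-isolated Ay (λ Az y∼z → none (_ , _ , y∼z , Ay , Az)) ⟨
      ∂ A                          ∎))
      where
      open ≤-Reasoning
      A⊖yx : (A ⊖ y) x ≡ true
      A⊖yx = trans (Adds.same (adds-⊖ {A = A} Ay) x≢y) Ax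

    -- The upper bound that ∂-add gives when v has at least k neighbours in A.
    ∂-add≤ : ∀ {v A B} k m → Adds v A B → k ≤ nbrs v A → ∂ A + 3 ≤ 2 * k + m → ∂ B ≤ m
    ∂-add≤ {v} {A} {B} k m add k≤ ≤m = +-cancelˡ-≤ (2 * k) (∂ B) m (begin
      2 * k + ∂ B              ≡⟨ +-comm (2 * k) _ ⟩
      ∂ B + 2 * k              ≤⟨ +-monoʳ-≤ (∂ B) (*-monoʳ-≤ 2 k≤) ⟩
      ∂ B + 2 * nbrs v A     ≡⟨ ∂-add add ⟩
      ∂ A + 3                  ≤⟨ ≤m ⟩
      2 * k + m                  ∎)
      where open ≤-Reasoning

    module _ (ess : EssentiallyEdgeConnected 4 G) where

      -- Small cuts in essentially 4-edge connected graphs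

      -- Two vertices on each side of a cut of size at most 3 would, by inner-edge,
      -- make that cut essential.
      outside-unique : ∀ {A p q x y} → p ≢ q → A p ≡ true → A q ≡ true → ∂ A ≤ 3 →
        A x ≡ false → A y ≡ false → x ≡ y
      outside-unique {A} {x = x} {y} p≢q Ap Aq ∂≤3 Ax Ay = decidable-stable (x ≟ y) λ x≢y →
        ess (δ G (tabulate A) , (tabulate A , refl) ,
             essential-cut (inner-edge p≢q Ap Aq ∂≤5)
               (inner-edge x≢y (cong not Ax) (cong not Ay) (subst (_≤ 5) (sym (∂-∁ A)) ∂≤5)) ,
             s≤s (subst (_≤ 3) (sym (trans (length-δ _) (∂-cong (lookup∘tabulate A)))) ∂≤3))
        where
        ∂≤5 : ∂ A ≤ 5
        ∂≤5 = ≤-trans ∂≤3 (m≤m+n 3 2)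

      inside-unique : ∀ {A p q x y} → p ≢ q → A p ≡ false → A q ≡ false → ∂ A ≤ 3 →
        A x ≡ true → A y ≡ true → x ≡ y
      inside-unique {A} p≢q Ap Aq ∂≤3 Ax Ay = outside-unique {not ∘ A} p≢q (cong not Ap) (cong not Aq)
        (subst (_≤ 3) (sym (∂-∁ A)) ∂≤3) (cong not Ax) (cong not Ay)

      3≤∂ : ∀ {A p q x} → p ≢ q → A p ≡ false → A q ≡ false → A x ≡ true → 3 ≤ ∂ A
      3≤∂ {A} {x = x} p≢q Ap Aq Ax with ∂ A ≤? 3
      ... | no ∂≰3  = <⇒≤ (≰⇒> ∂≰3)
      ... | yes ∂≤3 = subst (3 ≤_) (sym (∂-isolated Ax alone)) (m≤n+m 3 _)
        where
        alone : ∀ {z} → A z ≡ true → ¬ x ∼ z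
        alone Az x∼z = ∼⇒≢ x∼z (inside-unique p≢q Ap Aq ∂≤3 Ax Az)

      4≤∂ : ∀ {A p q x y} → p ≢ q → A p ≡ true → A q ≡ true → x ≢ y → A x ≡ false → A y ≡ false → 4 ≤ ∂ A
      4≤∂ p≢q Ap Aq x≢y Ax Ay = ≰⇒> λ ∂≤3 → x≢y (outside-unique p≢q Ap Aq ∂≤3 Ax Ay)

      -- Two nonadjacent vertices would have a cut of size 6.
      outside-pair-adjacent : ∀ {A x y} → x ≢ y → A x ≡ false → A y ≡ false →
        (∀ {z} → A z ≡ false → z ≡ x ⊎ z ≡ y) → ∂ A ≡ 4 → x ∼ y
      outside-pair-adjacent {A} x≢y Ax Ay only ∂≡4
        with inner-edge {not ∘ A} x≢y (cong not Ax) (cong not Ay) (subst (_≤ 5) (sym (trans (∂-∁ A) ∂≡4)) (m≤m+n 4 1))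
      ... | p , q , p∼q , Ap , Aq with only (not-injective Ap) | only (not-injective Aq)
      ... | inj₁ refl | inj₁ refl = contradiction refl (∼⇒≢ p∼q)
      ... | inj₁ refl | inj₂ refl = p∼q
      ... | inj₂ refl | inj₁ refl = ∼-sym p∼q
      ... | inj₂ refl | inj₂ refl = contradiction refl (∼⇒≢ p∼q)

      module _ (6<n : 6 < n) where

        -- Excluded small subgraphs

        -- The set of the entries of a list.
        ⟪_⟫ : List (Fin n) → VSet n
        ⟪ []     ⟫ = λ _ → false
        ⟪ x ∷ xs ⟫ = ⟪ xs ⟫ ⊕ x

        ∉⟪⟫ : ∀ {z} xs → z ∉ xs → ⟪ xs ⟫ z ≡ false
        ∉⟪⟫ []       _  = refl
        ∉⟪⟫ {z} (x ∷ xs) z∉ = trans (cong (_∨ ⟪ xs ⟫ z) (dec-false (z ≟ x) (z∉ ∘ here))) (∉⟪⟫ xs (z∉ ∘ there))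

        ∈⟪⟫ : ∀ {z} xs → z ∈ xs → ⟪ xs ⟫ z ≡ true
        ∈⟪⟫ {z} (x ∷ xs) z∈ with z ≟ x
        ... | yes _  = refl
        ∈⟪⟫ (x ∷ xs) (here z≡x) | no z≢x = contradiction z≡x z≢x
        ∈⟪⟫ (x ∷ xs) (there z∈) | no _   = ∈⟪⟫ xs z∈

        ∂-singleton : ∀ x → ∂ ⟪ x ∷ [] ⟫ ≤ 3
        ∂-singleton x = ∂-add≤ 0 3 (adds-⊕ {A = ⟪ [] ⟫} refl) z≤n
          (≤-reflexive (cong (_+ 3) (∑-0 {f = λ _ → 0} (E G) (λ _ → refl))))

        -- A new vertex with one known neighbour in the list raises the bound by 1, and one
        -- with two known neighbours lowers it by 1.
        ∂-∷₁ : ∀ {m x y} xs → x ∉ xs → y ∈ xs → x ∼ y → ∂ ⟪ xs ⟫ ≤ m → ∂ ⟪ x ∷ xs ⟫ ≤ 1 + m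
        ∂-∷₁ {m} xs x∉ y∈ x∼y ∂≤m = ∂-add≤ 1 (1 + m) (adds-⊕ (∉⟪⟫ xs x∉))
          (1≤nbrs ⟪ xs ⟫ x∼y (∈⟪⟫ xs y∈)) (≤-trans (+-monoˡ-≤ 3 ∂≤m) (≤-reflexive (+-comm m 3)))

        ∂-∷₂ : ∀ {m x y z} xs → x ∉ xs → y ≢ z → y ∈ xs → x ∼ y → z ∈ xs → x ∼ z →
          ∂ ⟪ xs ⟫ ≤ 1 + m → ∂ ⟪ x ∷ xs ⟫ ≤ m
        ∂-∷₂ {m} xs x∉ y≢z y∈ x∼y z∈ x∼z ∂≤ = ∂-add≤ 2 m (adds-⊕ (∉⟪⟫ xs x∉))
          (2≤nbrs ⟪ xs ⟫ y≢z x∼y (∈⟪⟫ xs y∈) x∼z (∈⟪⟫ xs z∈))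
          (≤-trans (+-monoˡ-≤ 3 ∂≤) (≤-reflexive (cong suc (+-comm m 3))))

        -- Two vertices lie outside the set because there are at least seven in all.
        3<∂-few : ∀ {x y} xs → length xs ≤ 3 → x ≢ y → ¬ ∂ ⟪ x ∷ y ∷ xs ⟫ ≤ 3
        3<∂-few {x} {y} xs short x≢y ∂≤3
          with fresh (x ∷ y ∷ xs) (≤-trans (s≤s (s≤s (s≤s short))) (<⇒≤ 6<n))
        ... | p , p∉ with fresh (p ∷ x ∷ y ∷ xs) (≤-trans (s≤s (s≤s (s≤s (s≤s short)))) 6<n)
        ... | q , q∉ = q∉ (here (sym (outside-unique x≢y
          (∈⟪⟫ (x ∷ y ∷ xs) (here refl)) (∈⟪⟫ (x ∷ y ∷ xs) (there (here refl))) ∂≤3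
          (∉⟪⟫ (x ∷ y ∷ xs) p∉) (∉⟪⟫ (x ∷ y ∷ xs) (q∉ ∘ there)))))

        -- Adding x, y and z in turn gives cuts of sizes at most 3, 4 and 3.
        no-triangle : ∀ {x y z} → x ∼ y → y ∼ z → ¬ z ∼ x
        no-triangle {x} {y} {z} x∼y y∼z z∼x = 3<∂-few (x ∷ []) (s≤s z≤n) (≢-sym (∼⇒≢ y∼z)) ∂zyx
          where
          ∂yx : ∂ ⟪ y ∷ x ∷ [] ⟫ ≤ 4
          ∂yx = ∂-∷₁ (x ∷ []) (λ { (here refl) → ∼⇒≢ x∼y refl }) (here refl) (∼-sym x∼y) (∂-singleton x)
          ∂zyx : ∂ ⟪ z ∷ y ∷ x ∷ [] ⟫ ≤ 3
          ∂zyx = ∂-∷₂ (y ∷ x ∷ []) (λ { (here refl) → ∼⇒≢ y∼z refl ; (there (here refl)) → ∼⇒≢ z∼x refl })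
            (∼⇒≢ x∼y) (there (here refl)) z∼x (here refl) (∼-sym y∼z) ∂yx

        -- Adding the vertices in the order a, c, v, d, u gives cuts of sizes at most
        -- 3, 4, 5, 4 and 3.
        no-K₂,₃ : ∀ {a v c d u} → a ≢ v → c ≢ d → c ≢ u → d ≢ u →
          a ∼ c → a ∼ d → a ∼ u → v ∼ c → v ∼ d → ¬ v ∼ u
        no-K₂,₃ {a} {v} {c} {d} {u} a≢v c≢d c≢u d≢u a∼c a∼d a∼u v∼c v∼d v∼u =
          3<∂-few (v ∷ c ∷ a ∷ []) ≤-refl (≢-sym d≢u) ∂udvca
          where
          ∂ca : ∂ ⟪ c ∷ a ∷ [] ⟫ ≤ 4
          ∂ca = ∂-∷₁ (a ∷ []) (λ { (here refl) → ∼⇒≢ a∼c refl }) (here refl) (∼-sym a∼c) (∂-singleton a)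

          v∉ : v ∉ c ∷ a ∷ []
          v∉ (here refl)         = ∼⇒≢ v∼c refl
          v∉ (there (here refl)) = a≢v refl

          ∂vca : ∂ ⟪ v ∷ c ∷ a ∷ [] ⟫ ≤ 5
          ∂vca = ∂-∷₁ (c ∷ a ∷ []) v∉ (here refl) v∼c ∂ca

          d∉ : d ∉ v ∷ c ∷ a ∷ []
          d∉ (here refl)                 = ∼⇒≢ v∼d refl
          d∉ (there (here refl))         = c≢d refl
          d∉ (there (there (here refl))) = ∼⇒≢ a∼d refl

          ∂dvca : ∂ ⟪ d ∷ v ∷ c ∷ a ∷ [] ⟫ ≤ 4
          ∂dvca = ∂-∷₂ (v ∷ c ∷ a ∷ []) d∉ a≢v
            (there (there (here refl))) (∼-sym a∼d) (here refl) (∼-sym v∼d) ∂vca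

          u∉ : u ∉ d ∷ v ∷ c ∷ a ∷ []
          u∉ (here refl)                         = d≢u refl
          u∉ (there (here refl))                 = ∼⇒≢ v∼u refl
          u∉ (there (there (here refl)))         = c≢u refl
          u∉ (there (there (there (here refl)))) = ∼⇒≢ a∼u refl

          ∂udvca : ∂ ⟪ u ∷ d ∷ v ∷ c ∷ a ∷ [] ⟫ ≤ 3
          ∂udvca = ∂-∷₂ (d ∷ v ∷ c ∷ a ∷ []) u∉ a≢v
            (there (there (there (here refl)))) (∼-sym a∼u) (there (here refl)) (∼-sym v∼u) ∂dvca

        -- Two cuts of size four through the same path

        -- A cut of size 4 through au and vd, with u on the side S, has u, v, c on that
        -- side and a, d on the other, unless S is the pair u, v.
        cut-sides : ∀ {S a u v c d} → a ∼ u → u ∼ v → v ∼ c → v ∼ d →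
          a ≢ v → u ≢ d → c ≢ d →
          S u ≡ true → S a ≡ false → S v xor S d ≡ true → ∂ S ≡ 4 → ¬ IsPair u v S →
          S v ≡ true × S c ≡ true × S d ≡ false
        cut-sides {S} {a} {u} {v} {c} {d} a∼u u∼v v∼c v∼d a≢v u≢d c≢d Su Sa vd ∂S≡4 notPair
          with S v in Sv
        ... | false = contradiction (∼-sym a∼v) (no-triangle a∼u u∼v)
          where
          add : Adds v S (S ⊕ v)
          add = adds-⊕ Sv

          ∂S⊕v≤3 : ∂ (S ⊕ v) ≤ 3
          ∂S⊕v≤3 = ∂-add≤ 2 3 add (2≤nbrs S u≢d (∼-sym u∼v) Su v∼d vd) (≤-reflexive (cong (_+ 3) ∂S≡4))

          outside : ∀ {z} → S z ≡ false → z ≡ a ⊎ z ≡ v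
          outside {z} Sz with z ≟ v
          ... | yes z≡v = inj₂ z≡v
          ... | no z≢v  = inj₁ (outside-unique (∼⇒≢ u∼v)
            (trans (sym (Adds.same add (∼⇒≢ u∼v))) Su) (Adds.after add) ∂S⊕v≤3
            (trans (sym (Adds.same add z≢v)) Sz) (trans (sym (Adds.same add a≢v)) Sa))

          a∼v : a ∼ v
          a∼v = outside-pair-adjacent a≢v Sa Sv outside ∂S≡4
        ... | true with S c in Sc
        ...   | true  = refl , refl , not-injective vd
        ...   | false = contradiction (Su , refl , only) notPair
          where
          add : Adds v (not ∘ S) ((not ∘ S) ⊕ v)
          add = adds-⊕ (cong not Sv)

          ∂≤3 : ∂ ((not ∘ S) ⊕ v) ≤ 3
          ∂≤3 = ∂-add≤ 2 3 add (2≤nbrs (not ∘ S) c≢d v∼c (cong not Sc) v∼d vd)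
            (≤-reflexive (cong (_+ 3) (trans (∂-∁ S) ∂S≡4)))

          only : ∀ x → S x ≡ true → x ≡ u ⊎ x ≡ v
          only x Sx with x ≟ v
          ... | yes x≡v = inj₂ x≡v
          ... | no x≢v  = inj₁ (outside-unique a≢v
            (trans (sym (Adds.same add a≢v)) (cong not Sa)) (Adds.after add) ∂≤3
            (trans (sym (Adds.same add x≢v)) (cong not Sx))
            (trans (sym (Adds.same add (∼⇒≢ u∼v))) (cong not Su)))

        -- Two cuts of size 4 that both separate u and v from the neighbour a of u, and that
        -- separate c from d in opposite ways, leave only a and d outside S; a cut of size 4
        -- then makes them adjacent.
        crossing-cuts-adjacent : ∀ {S T a u v c d} → a ∼ u → u ≢ v →
          S u ≡ true → T u ≡ true → S v ≡ true → T v ≡ true → S a ≡ false → T a ≡ false →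
          S c ≡ true → T c ≡ false → S d ≡ false → T d ≡ true →
          ∂ S ≡ 4 → ∂ T ≡ 4 → a ∼ d
        crossing-cuts-adjacent {S} {T} {a} {u} {v} {c} {d}
          a∼u u≢v Su Tu Sv Tv Sa Ta Sc Tc Sd Td ∂S≡4 ∂T≡4 =
          outside-pair-adjacent a≢d Sa Sd outside-S ∂S≡4
          where
          a≢c : a ≢ c
          a≢c refl = case trans (sym Sa) Sc of λ ()

          a≢d : a ≢ d
          a≢d refl = case trans (sym Ta) Td of λ ()

          -- Both differences are nonempty and miss u and v, so neither cut is below 3,
          -- while posimodularity bounds their sum by 6.
          ∂T∖S≤3 : ∂ (T ∖ᵛ S) ≤ 3
          ∂T∖S≤3 = +-cancelˡ-≤ 3 _ 3 (begin
            3 + ∂ (T ∖ᵛ S)             ≤⟨ +-monoˡ-≤ (∂ (T ∖ᵛ S)) (3≤∂ {S ∖ᵛ T} u≢v (∖-absent Su Tu) (∖-absent Sv Tv)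
                                          (cong₂ (λ p q → p ∧ not q) Sc Tc)) ⟩
            ∂ (S ∖ᵛ T) + ∂ (T ∖ᵛ S)    ≤⟨ +-cancelˡ-≤ 2 _ 6 (≤-trans (∂-posimodular a∼u Sa Ta Su Tu)
                                          (≤-reflexive (cong₂ _+_ ∂S≡4 ∂T≡4))) ⟩
            6                          ∎)
            where
            open ≤-Reasoning
            ∖-absent : ∀ {x} → S x ≡ true → T x ≡ true → (S ∖ᵛ T) x ≡ false
            ∖-absent = cong₂ (λ p q → p ∧ not q)

          T∖S-only : ∀ {z} → S z ≡ false → T z ≡ true → z ≡ d
          T∖S-only Sz Tz = inside-unique {T ∖ᵛ S} u≢v (in-T∖S Tu Su) (in-T∖S Tv Sv) ∂T∖S≤3 (in-T∖S Tz Sz) (in-T∖S Td Sd)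
            where
            in-T∖S : ∀ {x p q} → T x ≡ p → S x ≡ q → (T ∖ᵛ S) x ≡ p ∧ not q
            in-T∖S = cong₂ (λ p q → p ∧ not q)

          add-T : Adds d (S ∩ᵛ T) T
          add-T = record { before = cong (_∧ T d) Sd ; after = Td ; same = λ {x} → agree x }
            where
            agree : ∀ x → x ≢ d → S x ∧ T x ≡ T x
            agree x x≢d with S x in Sx | T x in Tx
            ... | true  | _     = refl
            ... | false | false = refl
            ... | false | true  = contradiction (T∖S-only Sx Tx) x≢d

          add-S : Adds d S (S ∪ᵛ T)
          add-S = record { before = Sd ; after = trans (cong (_∨ T d) Sd) Td ; same = λ {x} → agree x }
            where
            agree : ∀ x → x ≢ d → S x ≡ S x ∨ T x
            agree x x≢d with S x in Sx | T x in Tx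
            ... | true  | _     = refl
            ... | false | false = refl
            ... | false | true  = contradiction (T∖S-only Sx Tx) x≢d

          -- T arises from the intersection by adding d, and the intersection, which contains
          -- u and v but neither a nor c, has a cut of size at least 4.
          2≤nbrs-S∩T : 2 ≤ nbrs d (S ∩ᵛ T)
          2≤nbrs-S∩T = *-cancelˡ-< 2 1 _ (+-cancelˡ-≤ 4 3 _ (begin
            4 + 3                        ≤⟨ +-monoˡ-≤ 3 (4≤∂ {S ∩ᵛ T} u≢v (cong₂ _∧_ Su Tu) (cong₂ _∧_ Sv Tv)
                                             a≢c (cong₂ _∧_ Sa Ta) (cong₂ _∧_ Sc Tc)) ⟩
            ∂ (S ∩ᵛ T) + 3               ≡⟨ ∂-add add-T ⟨
            ∂ T + 2 * nbrs d (S ∩ᵛ T)    ≡⟨ cong (_+ 2 * nbrs d (S ∩ᵛ T)) ∂T≡4 ⟩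
            4 + 2 * nbrs d (S ∩ᵛ T)      ∎))
            where open ≤-Reasoning

          -- The union arises from S by adding d.
          ∂S∪T≤3 : ∂ (S ∪ᵛ T) ≤ 3
          ∂S∪T≤3 = ∂-add≤ 2 3 add-S
            (≤-trans 2≤nbrs-S∩T (nbrs-mono d (S ∩ᵛ T) S λ {x} → ∧-trueˡ (S x)))
            (≤-reflexive (cong (_+ 3) ∂S≡4))
            where
            ∧-trueˡ : ∀ p {q} → p ∧ q ≡ true → p ≡ true
            ∧-trueˡ true _ = refl

          outside-S : ∀ {z} → S z ≡ false → z ≡ a ⊎ z ≡ d
          outside-S {z} Sz with T z in Tz
          ... | true  = inj₂ (T∖S-only Sz Tz)
          ... | false = inj₁ (outside-unique {S ∪ᵛ T} u≢v (cong₂ _∨_ Su Tu) (cong₂ _∨_ Sv Tv) ∂S∪T≤3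
                          (cong₂ _∨_ Sz Tz) (cong₂ _∨_ Sa Ta))

        -- The adjacency of a and c is that of a and d with the roles of S, c and T, d
        -- exchanged.
        no-opposing-cuts : ∀ {S T a u v c d} → a ∼ u → u ∼ v → v ∼ c → v ∼ d →
          a ≢ v → u ≢ c → u ≢ d → c ≢ d →
          S u ≡ true → S a ≡ false → S v xor S d ≡ true → ∂ S ≡ 4 → ¬ IsPair u v S →
          T u ≡ true → T a ≡ false → T v xor T c ≡ true → ∂ T ≡ 4 → ¬ IsPair u v T → ⊥
        no-opposing-cuts a∼u u∼v v∼c v∼d a≢v u≢c u≢d c≢d Su Sa Svd ∂S≡4 ¬pairS Tu Ta Tvc ∂T≡4 ¬pairT
          with cut-sides a∼u u∼v v∼c v∼d a≢v u≢d c≢d Su Sa Svd ∂S≡4 ¬pairS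
             | cut-sides a∼u u∼v v∼d v∼c a≢v u≢c (≢-sym c≢d) Tu Ta Tvc ∂T≡4 ¬pairT
        ... | Sv , Sc , Sd | Tv , Td , Tc = no-K₂,₃ a≢v c≢d (≢-sym u≢c) (≢-sym u≢d)
          (crossing-cuts-adjacent a∼u (∼⇒≢ u∼v) Tu Su Tv Sv Ta Sa Td Sd Tc Sc ∂T≡4 ∂S≡4)
          (crossing-cuts-adjacent a∼u (∼⇒≢ u∼v) Su Tu Sv Tv Sa Ta Sc Tc Sd Td ∂S≡4 ∂T≡4)
          a∼u v∼c v∼d (∼-sym u∼v)

-- From subsets to characteristic functions

-- A cut through au is also the cut of a set with u inside and a outside: S itself or
-- its complement.  Excluding both the pair u, v and its complement for S excludes
-- the pair in either case.
normalise : ∀ (G : SimpleGraph n) S {a u v x} →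
  S ≢ ⁅ u ⁆ ∪ ⁅ v ⁆ → S ≢ ∁ (⁅ u ⁆ ∪ ⁅ v ⁆) →
  (a , u) ∈ᵉ δ G S → (v , x) ∈ᵉ δ G S → length (δ G S) ≡ 4 →
  ∃[ A ] A u ≡ true × A a ≡ false × A v xor A x ≡ true × ∂ G A ≡ 4 × ¬ IsPair u v A
normalise G S {a} {u} {v} {x} S≢ S≢∁ au vx len with lookup S u in Su
... | true  = lookup S , Su , not-injective (trans (xor-comm true _) a-xor) , ∈ᵉδ⇒xor G S vx ,
              trans (sym (length-δ G S)) len , λ pair → S≢ (lookup-ext λ y → sym (pair-lookup pair y))
  where
  a-xor : lookup S a xor true ≡ true
  a-xor = trans (cong (lookup S a xor_) (sym Su)) (∈ᵉδ⇒xor G S au)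
... | false = not ∘ lookup S , cong not Su , cong not a-in , trans (not-xor-not (lookup S v) _) (∈ᵉδ⇒xor G S vx) ,
              trans (∂-∁ G (lookup S)) (trans (sym (length-δ G S)) len) ,
              λ pair → S≢∁ (lookup-ext λ y → sym (begin
                lookup (∁ (⁅ u ⁆ ∪ ⁅ v ⁆)) y      ≡⟨ lookup-map y not (⁅ u ⁆ ∪ ⁅ v ⁆) ⟩
                not (lookup (⁅ u ⁆ ∪ ⁅ v ⁆) y)    ≡⟨ cong not (pair-lookup pair y) ⟩
                not (not (lookup S y))            ≡⟨ not-involutive _ ⟩
                lookup S y                        ∎))
  where
  open ≡-Reasoning
  a-in : lookup S a ≡ true
  a-in = trans (sym (xor-identityʳ _)) (trans (cong (lookup S a xor_) (sym Su)) (∈ᵉδ⇒xor G S au))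

lemma1 : ∀ {n : ℕ} (G : SimpleGraph n) →
    Cubic G → EssentiallyEdgeConnected 4 G → 6 < n →
    (a u v c d : Fin n) →
    (a , u) ∈ᵉ E G → (u , v) ∈ᵉ E G → (v , c) ∈ᵉ E G → (v , d) ∈ᵉ E G →
    AllPairs _≉ᵉ_ ((a , u) ∷ (u , v) ∷ (v , c) ∷ (v , d) ∷ []) →
    ¬ (∃[ S ] ∃[ S′ ]
    S ≢ ⁅ u ⁆ ∪ ⁅ v ⁆ × S ≢ ∁ (⁅ u ⁆ ∪ ⁅ v ⁆) ×
    S′ ≢ ⁅ u ⁆ ∪ ⁅ v ⁆ × S′ ≢ ∁ (⁅ u ⁆ ∪ ⁅ v ⁆) ×
    (a , u) ∈ᵉ δ G S × (v , d) ∈ᵉ δ G S ×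
    (a , u) ∈ᵉ δ G S′ × (v , c) ∈ᵉ δ G S′ ×
    length (δ G S) ≡ 4 × length (δ G S′) ≡ 4)
lemma1 G cubic ess 6<n a u v c d au uv vc vd
  ((au≉uv ∷ _) ∷ (uv≉vc ∷ uv≉vd ∷ []) ∷ (vc≉vd ∷ []) ∷ [] ∷ [])
  (S , S′ , S≢ , S≢∁ , S′≢ , S′≢∁ , auS , vdS , auS′ , vcS′ , lenS , lenS′)
  with normalise G S S≢ S≢∁ auS vdS lenS | normalise G S′ S′≢ S′≢∁ auS′ vcS′ lenS′
... | A , Au , Aa , Avd , ∂A≡4 , ¬pairA | B , Bu , Ba , Bvc , ∂B≡4 , ¬pairB =
  no-opposing-cuts G cubic ess 6<n (∈ᵉE⇒∼ G au) (∈ᵉE⇒∼ G uv) (∈ᵉE⇒∼ G vc) (∈ᵉE⇒∼ G vd)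
    (λ a≡v → au≉uv (inj₂ (cong (u ,_) a≡v))) (λ u≡c → uv≉vc (inj₂ (cong (v ,_) u≡c)))
    (λ u≡d → uv≉vd (inj₂ (cong (v ,_) u≡d))) (λ c≡d → vc≉vd (inj₁ (cong (v ,_) c≡d)))
    Au Aa Avd ∂A≡4 ¬pairA Bu Ba Bvc ∂B≡4 ¬pairB
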